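{- Let $f(x)\in\mathbf{Z}[x]$ be a polynomial of degree 1, and let $p$ be a good prime for $f(x)$. Then for every integer $m$ coprime to $p$ there exist infinitely many elements $d\in\mathcal{S}(f)$ such that $d\equiv m\pmod p$.
   Context: Squarefree integers may be negative and are nonzero. For a nonzero rational number $r$, its squarefree part $S(r)$ is the unique squarefree integer $d$ such that $r/d$ is a square in $\mathbf{Q}$. For a separable nonconstant $f(x)\in\mathbf{Z}[x]$, $\mathcal{S}(f)=\{S(f(r)) : r\in\mathbf{Q},\ f(r)\neq 0\}$. An odd prime $p$ is good for $f(x)$ if the reduced polynomial $\bar f(x)\in\mathbf{F}_p[x]$ has the same degree as $f(x)$ and has nonzero discriminant (a polynomial of degree 1 has discriminant 1). -}

module Defs where

open import Algebra.Bundles using (CommutativeRing)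
open import Data.Fin.Base using (Fin; zero; suc; toℕ; punchIn; splitAt)
open import Data.Integer.Base as ℤ using (ℤ; +_; 0ℤ; 1ℤ)
import Data.Integer.Divisibility as ℤ
open import Data.Integer.Divisibility.Signed as Signed using (divides)
import Data.Integer.Properties as ℤ
open import Data.Integer.Tactic.RingSolver using (solve-∀)
open import Data.List.Base using (List; []; _∷_; foldr; map)
open import Data.List.Membership.Propositional using (_∉_)
open import Data.Nat.Base as ℕ using (ℕ; zero; suc; _∸_; _≤ᵇ_)
open import Data.Nat.Coprimality as Coprimality using (1-coprimeTo)
import Data.Nat.Divisibility as ℕ
import Data.Nat.DivMod as ℕ
open import Data.Nat.Primality using (Prime)
open import Data.Product.Base using (_×_; ∃-syntax; _,_; proj₁; proj₂)
open import Data.Rational.Base as ℚ using (ℚ; mkℚ; 0ℚ)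
import Data.Rational.Properties as ℚ
open import Data.Sum.Base using ([_,_]′)
open import Data.Bool.Base using (if_then_else_)
open import Function.Base using (_$_)
open import Level using (0ℓ)
open import Relation.Binary.PropositionalEquality.Core
  using (_≡_; _≢_; refl; trans; cong; cong₂)
open import Relation.Nullary.Negation.Core using (¬_)
open import Relation.Unary using (Pred; _∈_)

-- A polynomial is the list of its coefficients, constant term first; trailing
-- zero coefficients are allowed.
module Polynomial {c ℓ} (R : CommutativeRing c ℓ) where

  open CommutativeRing R hiding (zero)
  open import Algebra.Properties.Monoid.Sum +-monoid using (sum)
  open import Algebra.Properties.Monoid.Mult +-monoid using () renaming (_×_ to _·_)
  open import Algebra.Properties.Semiring.Exp semiring using (_^_)

  Poly : Set c
  Poly = List Carrier

  coeff : Poly → ℕ → Carrier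
  coeff []      _       = 0#
  coeff (a ∷ f) zero    = a
  coeff (a ∷ f) (suc i) = coeff f i

  eval : Poly → Carrier → Carrier
  eval f x = foldr (λ a v → a + x * v) 0# f

  HasDegree : Poly → ℕ → Set ℓ
  HasDegree f n = ¬ (coeff f n ≈ 0#) × (∀ i → n ℕ.< i → coeff f i ≈ 0#)

  -- Laplace expansion along the first row.
  det : ∀ {n} → (Fin n → Fin n → Carrier) → Carrier
  det {zero}  M = 1#
  det {suc n} M = sum λ j →
    ((- 1#) ^ toℕ j * M zero j) * det (λ i k → M (suc i) (punchIn j k))

  monomial : ℕ → ℕ → Carrier
  monomial n i = if n ℕ.≡ᵇ i then 1# else 0#

  -- The coefficients of the derivative, and of the product with xˢ.
  derivative : (ℕ → Carrier) → (ℕ → Carrier)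
  derivative a i = suc i · a (suc i)

  shift : ℕ → (ℕ → Carrier) → (ℕ → Carrier)
  shift s a i = if s ≤ᵇ i then a (i ∸ s) else 0#

  -- The Sylvester matrix of f and f′ for f = Σ aᵢxⁱ of degree k + 1: the rows
  -- are xᵏ⁻¹f, …, f, xᵏf′, …, f′ and the columns are the exponents 2k, …, 0.
  sylvester : ∀ k → (ℕ → Carrier) → Fin (k ℕ.+ suc k) → Fin (k ℕ.+ suc k) → Carrier
  sylvester k a i j =
    [ (λ r → shift (k ∸ suc (toℕ r)) a e)
    , (λ r → shift (k ∸ toℕ r) (derivative a) e)
    ]′ (splitAt k i)
    where e = (k ℕ.+ k) ∸ toℕ j

  -- For f of degree n with leading coefficient a, the discriminant is
  -- (-1)^(n(n-1)/2) a⁻¹ Res(f, f′), here with n = k + 1.  The first column of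
  -- the Sylvester matrix is a times that of the Sylvester matrix of xⁿ, so
  -- a⁻¹ is applied by using the latter as first column; this makes sense over
  -- any commutative ring, and gives 1 when n = 1.
  discriminant : ℕ → Poly → Carrier
  discriminant k f = (- 1#) ^ ((suc k ℕ.* k) ℕ./ 2) * det M
    where
    M : Fin (k ℕ.+ suc k) → Fin (k ℕ.+ suc k) → Carrier
    M i j = sylvester k (if toℕ j ℕ.≡ᵇ 0 then monomial (suc k) else coeff f) i j

infix 4 _≡_[mod_]

record _≡_[mod_] (a b : ℤ) (n : ℕ) : Set where
  constructor congruent
  field
    n∣a-b : + n Signed.∣ a ℤ.- b

-- ℤ/nℤ as a setoid quotient: its elements are integers, compared modulo n.
-- In particular an integer polynomial is its own reduction modulo n.
ℤ/ : ℕ → CommutativeRing 0ℓ 0ℓ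
ℤ/ n = record
  { Carrier = ℤ
  ; _≈_     = _≡_[mod n ]
  ; _+_     = ℤ._+_
  ; _*_     = ℤ._*_
  ; -_      = ℤ.-_
  ; 0#      = 0ℤ
  ; 1#      = 1ℤ
  ; isCommutativeRing = record
    { isRing = record
      { +-isAbelianGroup = record
        { isGroup = record
          { isMonoid = record
            { isSemigroup = record
              { isMagma = record
                { isEquivalence = record { refl = ≈-refl ; sym = ≈-sym ; trans = ≈-trans }
                ; ∙-cong = +-cong
                }
              ; assoc = λ a b c → ≡⇒≈ (ℤ.+-assoc a b c)
              }
            ; identity = (λ a → ≡⇒≈ (ℤ.+-identityˡ a)) , (λ a → ≡⇒≈ (ℤ.+-identityʳ a))
            }
          ; inverse = (λ a → ≡⇒≈ (ℤ.+-inverseˡ a)) , (λ a → ≡⇒≈ (ℤ.+-inverseʳ a))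
          ; ⁻¹-cong = -‿cong
          }
        ; comm = λ a b → ≡⇒≈ (ℤ.+-comm a b)
        }
      ; *-cong     = *-cong
      ; *-assoc    = λ a b c → ≡⇒≈ (ℤ.*-assoc a b c)
      ; *-identity = (λ a → ≡⇒≈ (ℤ.*-identityˡ a)) , (λ a → ≡⇒≈ (ℤ.*-identityʳ a))
      ; distrib    = (λ a b c → ≡⇒≈ (ℤ.*-distribˡ-+ a b c))
                   , (λ a b c → ≡⇒≈ (ℤ.*-distribʳ-+ a b c))
      }
    ; *-comm = λ a b → ≡⇒≈ (ℤ.*-comm a b)
    }
  }
  where
  infix 4 _≈_
  _≈_ : ℤ → ℤ → Set
  a ≈ b = a ≡ b [mod n ]

  ≡⇒≈ : ∀ {a b} → a ≡ b → a ≈ b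
  ≡⇒≈ {a} refl = congruent (divides 0ℤ (ℤ.+-inverseʳ a))

  ≈-refl : ∀ {a} → a ≈ a
  ≈-refl = ≡⇒≈ refl

  ≈-sym : ∀ {a b} → a ≈ b → b ≈ a
  ≈-sym {a} {b} (congruent (divides q eq)) =
    congruent $ divides (ℤ.- q) (trans (flip a b) (trans (cong ℤ.-_ eq) (ℤ.neg-distribˡ-* q (+ n))))
    where
    flip : ∀ a b → b ℤ.- a ≡ ℤ.- (a ℤ.- b)
    flip = solve-∀

  ≈-trans : ∀ {a b c} → a ≈ b → b ≈ c → a ≈ c
  ≈-trans {a} {b} {c} (congruent (divides q eq)) (congruent (divides r eq′)) =
    congruent $ divides (q ℤ.+ r) (trans (split a b c) (trans (cong₂ ℤ._+_ eq eq′) (collect q r (+ n))))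
    where
    split : ∀ a b c → a ℤ.- c ≡ (a ℤ.- b) ℤ.+ (b ℤ.- c)
    split = solve-∀
    collect : ∀ q r k → q ℤ.* k ℤ.+ r ℤ.* k ≡ (q ℤ.+ r) ℤ.* k
    collect = solve-∀

  +-cong : ∀ {a b c d} → a ≈ b → c ≈ d → a ℤ.+ c ≈ b ℤ.+ d
  +-cong {a} {b} {c} {d} (congruent (divides q eq)) (congruent (divides r eq′)) =
    congruent $ divides (q ℤ.+ r) (trans (split a b c d) (trans (cong₂ ℤ._+_ eq eq′) (collect q r (+ n))))
    where
    split : ∀ a b c d → (a ℤ.+ c) ℤ.- (b ℤ.+ d) ≡ (a ℤ.- b) ℤ.+ (c ℤ.- d)
    split = solve-∀
    collect : ∀ q r k → q ℤ.* k ℤ.+ r ℤ.* k ≡ (q ℤ.+ r) ℤ.* k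
    collect = solve-∀

  *-cong : ∀ {a b c d} → a ≈ b → c ≈ d → a ℤ.* c ≈ b ℤ.* d
  *-cong {a} {b} {c} {d} (congruent (divides q eq)) (congruent (divides r eq′)) =
    congruent $ divides (q ℤ.* c ℤ.+ b ℤ.* r)
      (trans (split a b c d)
        (trans (cong₂ (λ u v → u ℤ.* c ℤ.+ b ℤ.* v) eq eq′) (collect q r b c (+ n))))
    where
    split : ∀ a b c d → a ℤ.* c ℤ.- b ℤ.* d ≡ (a ℤ.- b) ℤ.* c ℤ.+ b ℤ.* (c ℤ.- d)
    split = solve-∀
    collect : ∀ q r b c k →
      (q ℤ.* k) ℤ.* c ℤ.+ b ℤ.* (r ℤ.* k) ≡ (q ℤ.* c ℤ.+ b ℤ.* r) ℤ.* k
    collect = solve-∀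

  -‿cong : ∀ {a b} → a ≈ b → ℤ.- a ≈ ℤ.- b
  -‿cong {a} {b} (congruent (divides q eq)) =
    congruent $ divides (ℤ.- q) (trans (flip a b) (trans (cong ℤ.-_ eq) (ℤ.neg-distribˡ-* q (+ n))))
    where
    flip : ∀ a b → (ℤ.- a) ℤ.- (ℤ.- b) ≡ ℤ.- (a ℤ.- b)
    flip = solve-∀

module ℤ[x]     = Polynomial ℤ.+-*-commutativeRing
module ℤ/[x] n  = Polynomial (ℤ/ n)
module ℚ[x]     = Polynomial ℚ.+-*-commutativeRing

fromℤ : ℤ → ℚ
fromℤ a = mkℚ a 0 (Coprimality.sym (1-coprimeTo ℤ.∣ a ∣))

evalℚ : ℤ[x].Poly → ℚ → ℚ
evalℚ f = ℚ[x].eval (map fromℤ f)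

Squarefree : ℤ → Set
Squarefree d = ℤ.NonZero d × (∀ k → k ℤ.* k ℤ.∣ d → ℤ.∣ k ∣ ≡ 1)

-- The graph of S: d is the squarefree part of r.  Only meaningful for r ≢ 0ℚ.
IsSquarefreePart : ℚ → ℤ → Set
IsSquarefreePart r d = ∃[ sf ] ∃[ s ] quotient sf ≡ s ℚ.* s
  where
  quotient : Squarefree d → ℚ
  quotient sf = ℚ._÷_ r (fromℤ d) ⦃ proj₁ sf ⦄

𝒮 : ℤ[x].Poly → Pred ℤ 0ℓ
𝒮 f d = ∃[ r ] evalℚ f r ≢ 0ℚ × IsSquarefreePart (evalℚ f r) d

-- p is good for f; n = k + 1 is the common degree of f and its reduction.
record Good (f : ℤ[x].Poly) (p : ℕ) : Set where
  field
    prime          : Prime p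
    odd            : ¬ (2 ℕ.∣ p)
    k              : ℕ
    degree         : ℤ[x].HasDegree f (suc k)
    reducedDegree  : ℤ/[x].HasDegree p f (suc k)
    discriminant≉0 : ¬ (ℤ/[x].discriminant p k f ≡ 0ℤ [mod p ])

Infinite : Pred ℤ 0ℓ → Set
Infinite P = ∀ (xs : List ℤ) → ∃[ d ] d ∈ P × d ∉ xs

{-# OPTIONS --safe #-}

-- Since f is linear, it takes every rational value, so 𝒮 f contains every
-- squarefree integer and it is enough to find arbitrarily large squarefree
-- numbers a + pn with a coprime to p.  Among n < N at most ⌊N/k²⌋ + 1 satisfy
-- k² ∣ a + pn, and ⌊N/k²⌋ ≤ ⌊N/(k-1)⌋ - ⌊N/k⌋ telescopes; splitting off k = 2,
-- at most ⌊N/4⌋ + ⌊N/2⌋ + j values of n are removed by k = 2, …, j + 1.  For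
-- N = 4(j + 1) and j = a + 4p some n survives, and a + pn < (j + 1)².
module Submission where

open import Defs
open import Data.Nat.Base using (ℕ)
open import Data.Integer.Base using (ℤ; +_)
open import Data.Integer.Coprimality using (Coprime)
open import Data.Product.Base using (_×_)
open import Relation.Unary using (_∈_)

open import Data.Empty using (⊥-elim)
open import Data.Integer.Base as ℤ using (0ℤ; ∣_∣)
import Data.Integer.DivMod as ℤ
import Data.Integer.Divisibility.Signed as Signed
import Data.Integer.Properties as ℤ
open import Data.Integer.Tactic.RingSolver using (solve-∀)
open import Data.List.Base using ([]; _∷_; map)
open import Data.List.Extrema.Nat using (max; xs≤max)
open import Data.List.Membership.Propositional using (_∉_)
open import Data.List.Membership.Propositional.Properties using (∈-map⁺)
import Data.List.Relation.Unary.All as All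
open import Data.Nat.Base
  using (zero; suc; _+_; _*_; _∸_; _/_; _≤_; _<_; z≤n; s≤s; z<s; s<s; s≤s⁻¹; NonZero; >-nonZero; ≢-nonZero⁻¹)
import Data.Nat.Coprimality as ℕ
open import Data.Nat.Divisibility
  using (_∣_; _∣?_; ∣-refl; ∣-trans; ∣⇒≤; 0∣⇒≡0; ∣m+n∣m⇒∣n; ∣m⇒∣m*n)
open import Data.Nat.DivMod
  using (/-monoˡ-≤; m*n/n≡m; m/n*n≤m; m/n/o≡m/[n*o]; n/n≡1; +-distrib-/-∣ʳ)
open import Data.Nat.Primality using (prime⇒nonZero)
open import Data.Nat.Properties
open import Data.Nat.Tactic.RingSolver using () renaming (solve-∀ to ℕ-solve-∀)
open import Data.Product.Base using (∃-syntax; _,_; proj₁; proj₂)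
open import Data.Rational.Base as ℚ using (0ℚ; 1ℚ; 1/_)
import Data.Rational.Properties as ℚ
import Algebra.Properties.AbelianGroup ℚ.+-0-abelianGroup as AbelianGroup
open import Data.Sum.Base using (_⊎_; inj₁; inj₂)
open import Function.Base using (_∘_)
open import Relation.Binary.PropositionalEquality
  using (_≡_; _≢_; refl; sym; trans; cong; cong₂; subst; module ≡-Reasoning)
open import Relation.Nullary using (¬_; yes; no)
open import Relation.Nullary.Decidable using (¬?)
open import Relation.Unary using (Pred; Decidable)
open import Level using (Level)

private variable
  ℓ ℓ₁ ℓ₂ ℓ₃ : Level

count : {P : Pred ℕ ℓ} → Decidable P → ℕ → ℕ
count P? zero    = 0
count P? (suc n) with P? n
... | yes _ = suc (count P? n)
... | no  _ = count P? n

count-universal : {P : Pred ℕ ℓ} (P? : Decidable P) → (∀ n → P n) → ∀ N → count P? N ≡ N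
count-universal P? all zero    = refl
count-universal P? all (suc N) with P? N
... | yes _ = cong suc (count-universal P? all N)
... | no ¬p = ⊥-elim (¬p (all N))

count-⊎ : {P : Pred ℕ ℓ₁} {Q : Pred ℕ ℓ₂} {R : Pred ℕ ℓ₃}
          (P? : Decidable P) (Q? : Decidable Q) (R? : Decidable R) →
          (∀ n → P n → Q n ⊎ R n) → ∀ N → count P? N ≤ count Q? N + count R? N
count-⊎ P? Q? R? split zero    = z≤n
count-⊎ P? Q? R? split (suc N) with count-⊎ P? Q? R? split N | P? N | Q? N | R? N
... | ih | yes p | yes q | yes r = s≤s (≤-trans ih (+-monoʳ-≤ _ (n≤1+n _)))
... | ih | yes p | yes q | no ¬r = s≤s ih
... | ih | yes p | no ¬q | yes r = ≤-trans (s≤s ih) (≤-reflexive (sym (+-suc _ _)))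
... | ih | no ¬p | yes q | yes r = m≤n⇒m≤1+n (≤-trans ih (+-monoʳ-≤ _ (n≤1+n _)))
... | ih | no ¬p | yes q | no ¬r = m≤n⇒m≤1+n ih
... | ih | no ¬p | no ¬q | yes r = ≤-trans ih (+-monoʳ-≤ _ (n≤1+n _))
... | ih | no ¬p | no ¬q | no ¬r = ih
... | ih | yes p | no ¬q | no ¬r with split N p
...   | inj₁ q = ⊥-elim (¬q q)
...   | inj₂ r = ⊥-elim (¬r r)

count-positive : {P : Pred ℕ ℓ} (P? : Decidable P) → ∀ N → 0 < count P? N → ∃[ n ] n < N × P n
count-positive P? (suc N) 0<c with P? N
... | yes p = N , n<1+n N , p
... | no  _ with count-positive P? N 0<c
...   | n , n<N , p = n , m<n⇒m<1+n n<N , p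

Separated : ℕ → Pred ℕ ℓ → Set ℓ
Separated q P = ∀ {i j} → i < j → P i → P j → i + q ≤ j

module _ {P : Pred ℕ ℓ} (P? : Decidable P) {q : ℕ} (separated : Separated q P) where

  count-last : ∀ N → count P? N ≡ 0 ⊎ (∃[ i ] i < N × P i × count P? N * q ≤ i + q)
  count-last zero    = inj₁ refl
  count-last (suc N) with P? N | count-last N
  ... | yes p | inj₁ c≡0 = inj₂ (N , n<1+n N , p ,
    subst (λ c → suc c * q ≤ N + q) (sym c≡0) (≤-trans (≤-reflexive (*-identityˡ q)) (m≤n+m q N)))
  ... | yes p | inj₂ (i , i<N , pᵢ , cq≤i+q) = inj₂ (N , n<1+n N , p ,
    ≤-trans (+-monoʳ-≤ q (≤-trans cq≤i+q (separated i<N pᵢ p))) (≤-reflexive (+-comm q N)))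
  ... | no _ | inj₁ c≡0 = inj₁ c≡0
  ... | no _ | inj₂ (i , i<N , rest) = inj₂ (i , m<n⇒m<1+n i<N , rest)

  count-separated : .{{_ : NonZero q}} → ∀ N → count P? N ≤ N / q + 1
  count-separated N with count-last N
  ... | inj₁ c≡0 = subst (_≤ N / q + 1) (sym c≡0) z≤n
  ... | inj₂ (i , i<N , _ , cq≤i+q) = begin
    count P? N         ≡⟨ m*n/n≡m _ q ⟨
    count P? N * q / q ≤⟨ /-monoˡ-≤ q (≤-trans cq≤i+q (+-monoˡ-≤ q (<⇒≤ i<N))) ⟩
    (N + q) / q        ≡⟨ +-distrib-/-∣ʳ N ∣-refl ⟩
    N / q + q / q      ≡⟨ cong (λ u → N / q + u) (n/n≡1 q) ⟩
    N / q + 1          ∎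
    where open ≤-Reasoning

∣-separated : ∀ {a p q} → ℕ.Coprime a p → Separated q (λ n → q ∣ a + p * n)
∣-separated {a} {p} {q} a⊥p {i} {j} i<j q∣i q∣j = begin
  i + q       ≤⟨ +-monoʳ-≤ i (∣⇒≤ {{>-nonZero (m<n⇒0<n∸m i<j)}} q∣j∸i) ⟩
  i + (j ∸ i) ≡⟨ m+[n∸m]≡n (<⇒≤ i<j) ⟩
  j           ∎
  where
  open ≤-Reasoning
  q⊥p : ℕ.Coprime q p
  q⊥p {d} (d∣q , d∣p) = a⊥p
    ( ∣m+n∣m⇒∣n (subst (d ∣_) (+-comm a (p * i)) (∣-trans d∣q q∣i)) (∣m⇒∣m*n i d∣p)
    , d∣p )
  difference : a + p * j ≡ (a + p * i) + p * (j ∸ i)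
  difference = begin-equality
    a + p * j                   ≡⟨ cong (λ n → a + p * n) (m+[n∸m]≡n (<⇒≤ i<j)) ⟨
    a + p * (i + (j ∸ i))       ≡⟨ cong (λ u → a + u) (*-distribˡ-+ p i (j ∸ i)) ⟩
    a + (p * i + p * (j ∸ i))   ≡⟨ +-assoc a _ _ ⟨
    (a + p * i) + p * (j ∸ i)   ∎
  q∣j∸i : q ∣ j ∸ i
  q∣j∸i = ℕ.coprime-divisor q⊥p (∣m+n∣m⇒∣n (subst (q ∣_) difference q∣j) q∣i)

N/[2+k]+N/[2+k]²≤N/[1+k] : ∀ N k → N / (2 + k) + N / ((2 + k) * (2 + k)) ≤ N / (1 + k)
N/[2+k]+N/[2+k]²≤N/[1+k] N k = begin
  q + N / ((2 + k) * (2 + k)) ≡⟨ cong (λ u → q + u) (m/n/o≡m/[n*o] N (2 + k) (2 + k)) ⟨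
  q + r                       ≡⟨ m*n/n≡m (q + r) (1 + k) ⟨
  (q + r) * (1 + k) / (1 + k) ≤⟨ /-monoˡ-≤ (1 + k) bound ⟩
  N / (1 + k)                 ∎
  where
  open ≤-Reasoning
  q = N / (2 + k)
  r = q / (2 + k)
  bound : (q + r) * (1 + k) ≤ N
  bound = begin
    (q + r) * (1 + k)         ≡⟨ *-distribʳ-+ (1 + k) q r ⟩
    q * (1 + k) + r * (1 + k) ≤⟨ +-monoʳ-≤ _ (≤-trans (*-monoʳ-≤ r (n≤1+n _)) (m/n*n≤m q (2 + k))) ⟩
    q * (1 + k) + q           ≡⟨ +-comm _ q ⟩
    q + q * (1 + k)           ≡⟨ *-suc q (1 + k) ⟨
    q * (2 + k)               ≤⟨ m/n*n≤m N (2 + k) ⟩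
    N                         ∎

module Sieve (a p : ℕ) (a⊥p : ℕ.Coprime a p) where

  Struck : ℕ → Pred ℕ _
  Struck i n = (2 + i) * (2 + i) ∣ a + p * n

  Struck? : ∀ i → Decidable (Struck i)
  Struck? i n = (2 + i) * (2 + i) ∣? a + p * n

  Sifted : ℕ → Pred ℕ _
  Sifted j n = ∀ {i} → i < j → ¬ Struck i n

  Sifted? : ∀ j → Decidable (Sifted j)
  Sifted? j n = allUpTo? (λ i → ¬? (Struck? i n)) j

  sift : ∀ j N → count (Sifted? j) N ≤ count (Sifted? (suc j)) N + (N / ((2 + j) * (2 + j)) + 1)
  sift j N = ≤-trans
    (count-⊎ (Sifted? j) (Sifted? (suc j)) (Struck? j) split N)
    (+-monoʳ-≤ _ (count-separated (Struck? j) (∣-separated a⊥p) N))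
    where
    split : ∀ n → Sifted j n → Sifted (suc j) n ⊎ Struck j n
    split n sifted with Struck? j n
    ... | yes struck = inj₂ struck
    ... | no ¬struck = inj₁ λ i<1+j → [sifted] (m<1+n⇒m<n∨m≡n i<1+j)
      where
      [sifted] : ∀ {i} → i < j ⊎ i ≡ j → ¬ Struck i n
      [sifted] (inj₁ i<j)  = sifted i<j
      [sifted] (inj₂ refl) = ¬struck

  sieve : ∀ j N →
    N + N / (2 + j) ≤ count (Sifted? (suc j)) N + (suc j + (N / 4 + N / 2))
  sieve zero N = begin
    N + N / 2                                  ≡⟨ cong (_+ N / 2) (count-universal (Sifted? 0) (λ _ ()) N) ⟨
    count (Sifted? 0) N + N / 2                ≤⟨ +-monoˡ-≤ (N / 2) (sift 0 N) ⟩
    count (Sifted? 1) N + (N / 4 + 1) + N / 2  ≡⟨ rearrange (count (Sifted? 1) N) (N / 4) (N / 2) ⟩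
    count (Sifted? 1) N + (1 + (N / 4 + N / 2)) ∎
    where
    open ≤-Reasoning
    rearrange : ∀ c u v → c + (u + 1) + v ≡ c + (1 + (u + v))
    rearrange = ℕ-solve-∀
  sieve (suc j) N = +-cancelʳ-≤ r _ _ (begin
    N + N / (3 + j) + r                           ≡⟨ +-assoc N _ r ⟩
    N + (N / (3 + j) + r)                         ≤⟨ +-monoʳ-≤ N (N/[2+k]+N/[2+k]²≤N/[1+k] N (suc j)) ⟩
    N + N / (2 + j)                               ≤⟨ sieve j N ⟩
    count (Sifted? (suc j)) N + (suc j + u)       ≤⟨ +-monoˡ-≤ _ (sift (suc j) N) ⟩
    c + (r + 1) + (suc j + u)                     ≡⟨ rearrange c r j u ⟩
    c + (2 + j + u) + r                           ∎)
    where
    open ≤-Reasoning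
    r = N / ((3 + j) * (3 + j))
    u = N / 4 + N / 2
    c = count (Sifted? (2 + j)) N
    rearrange : ∀ c r j u → c + (r + 1) + (suc j + u) ≡ c + (2 + j + u) + r
    rearrange = ℕ-solve-∀

  sifted-exists : ∀ j → ∃[ n ] n < (2 + j) * 4 × Sifted (suc j) n
  sifted-exists j = count-positive (Sifted? (suc j)) N (+-cancelʳ-≤ (suc j + J * 3) 1 c (begin
    J + J * 3                      ≡⟨ *-suc J 3 ⟨
    N                              ≤⟨ m≤m+n N (N / J) ⟩
    N + N / J                      ≤⟨ sieve j N ⟩
    c + (suc j + (N / 4 + N / 2))  ≡⟨ cong₂ (λ u v → c + (suc j + (u + v))) (m*n/n≡m J 4) N/2≡J*2 ⟩
    c + (suc j + (J + J * 2))      ≡⟨ cong (λ u → c + (suc j + u)) (*-suc J 2) ⟨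
    c + (suc j + J * 3)            ∎))
    where
    open ≤-Reasoning
    J = 2 + j
    N = J * 4
    c = count (Sifted? (suc j)) N
    N/2≡J*2 : N / 2 ≡ J * 2
    N/2≡J*2 = trans (cong (_/ 2) (sym (*-assoc J 2 2))) (m*n/n≡m (J * 2) 2)

squarefree-in-progression : ∀ a p .{{_ : NonZero a}} → ℕ.Coprime a p →
  ∃[ n ] (∀ k → k * k ∣ a + p * n → k ≡ 1)
squarefree-in-progression (suc a′) p a⊥p with Sieve.sifted-exists (suc a′) p a⊥p (a′ + 4 * p)
... | n , n<N , sifted = n , squarefree
  where
  open ≤-Reasoning
  a = suc a′
  j = suc (a′ + 4 * p)
  squarefree : ∀ k → k * k ∣ a + p * n → k ≡ 1
  squarefree zero          0∣x with () ← 0∣⇒≡0 0∣x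
  squarefree (suc zero)    _   = refl
  squarefree k@(suc (suc i)) k²∣x = ⊥-elim (sifted (<⇒≤ (s≤s⁻¹ k<1+j)) k²∣x)
    where
    expand : ∀ a′ p → (1 + (a′ + 4 * p)) * (2 + (a′ + 4 * p))
                       ≡ (1 + a′ + p * ((2 + (a′ + 4 * p)) * 4)) + (1 + a′) * (1 + (a′ + 4 * p))
    expand = ℕ-solve-∀
    k²<[1+j]² : k * k < (1 + j) * (1 + j)
    k²<[1+j]² = begin-strict
      k * k                               ≤⟨ ∣⇒≤ k²∣x ⟩
      a + p * n                           ≤⟨ +-monoʳ-≤ a (*-monoʳ-≤ p (<⇒≤ n<N)) ⟩
      a + p * ((1 + j) * 4)               ≤⟨ m≤m+n _ (a * j) ⟩
      a + p * ((1 + j) * 4) + a * j       ≡⟨ expand a′ p ⟨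
      j * (1 + j)                         <⟨ m<n+m (j * (1 + j)) {1 + j} z<s ⟩
      (1 + j) * (1 + j)                   ∎
    k<1+j : k < 1 + j
    k<1+j = ≰⇒> λ 1+j≤k → <⇒≱ k²<[1+j]² (*-mono-≤ 1+j≤k 1+j≤k)

squarefree∈𝒮 : ∀ f → ℤ[x].HasDegree f 1 → ∀ d → Squarefree d → d ∈ 𝒮 f
squarefree∈𝒮 []              (f₁≢0 , _)      d sf = ⊥-elim (f₁≢0 refl)
squarefree∈𝒮 (b ∷ [])        (f₁≢0 , _)      d sf = ⊥-elim (f₁≢0 refl)
squarefree∈𝒮 f@(b ∷ a ∷ g) (a≢0 , higher) d sf =
  r , (λ f[r]≡0 → d≢0 (cong ℚ.↥_ (trans (sym f[r]≡d) f[r]≡0))) , sf , 1ℚ , quotient≡1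
  where
  open ≡-Reasoning
  instance
    a-nonZero : ℤ.NonZero a
    a-nonZero = ℤ.≢-nonZero a≢0
  d≢0 : d ≢ 0ℤ
  d≢0 = ≢-nonZero⁻¹ ∣ d ∣ {{proj₁ sf}} ∘ cong ∣_∣
  r = (fromℤ d ℚ.- fromℤ b) ℚ.* 1/ fromℤ a

  eval-zero : ∀ g → (∀ i → ℤ[x].coeff g i ≡ 0ℤ) → evalℚ g r ≡ 0ℚ
  eval-zero []      _     = refl
  eval-zero (c ∷ g) all≡0 = begin
    fromℤ c ℚ.+ r ℚ.* evalℚ g r ≡⟨ cong₂ (λ u v → fromℤ u ℚ.+ r ℚ.* v) (all≡0 0) (eval-zero g (all≡0 ∘ suc)) ⟩
    0ℚ ℚ.+ r ℚ.* 0ℚ             ≡⟨ ℚ.+-identityˡ _ ⟩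
    r ℚ.* 0ℚ                    ≡⟨ ℚ.*-zeroʳ r ⟩
    0ℚ                          ∎

  f[r]≡d : evalℚ f r ≡ fromℤ d
  f[r]≡d = begin
    fromℤ b ℚ.+ r ℚ.* (fromℤ a ℚ.+ r ℚ.* evalℚ g r)
      ≡⟨ cong (λ v → fromℤ b ℚ.+ r ℚ.* (fromℤ a ℚ.+ r ℚ.* v)) (eval-zero g λ i → higher (2 + i) (s<s z<s)) ⟩
    fromℤ b ℚ.+ r ℚ.* (fromℤ a ℚ.+ r ℚ.* 0ℚ)
      ≡⟨ cong (λ v → fromℤ b ℚ.+ r ℚ.* (fromℤ a ℚ.+ v)) (ℚ.*-zeroʳ r) ⟩
    fromℤ b ℚ.+ r ℚ.* (fromℤ a ℚ.+ 0ℚ)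
      ≡⟨ cong (λ v → fromℤ b ℚ.+ r ℚ.* v) (ℚ.+-identityʳ (fromℤ a)) ⟩
    fromℤ b ℚ.+ (fromℤ d ℚ.- fromℤ b) ℚ.* 1/ fromℤ a ℚ.* fromℤ a
      ≡⟨ cong (fromℤ b ℚ.+_) (ℚ.*-assoc (fromℤ d ℚ.- fromℤ b) _ _) ⟩
    fromℤ b ℚ.+ (fromℤ d ℚ.- fromℤ b) ℚ.* (1/ fromℤ a ℚ.* fromℤ a)
      ≡⟨ cong (λ v → fromℤ b ℚ.+ (fromℤ d ℚ.- fromℤ b) ℚ.* v) (ℚ.*-inverseˡ (fromℤ a)) ⟩
    fromℤ b ℚ.+ (fromℤ d ℚ.- fromℤ b) ℚ.* 1ℚ
      ≡⟨ cong (fromℤ b ℚ.+_) (ℚ.*-identityʳ (fromℤ d ℚ.- fromℤ b)) ⟩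
    fromℤ b ℚ.+ (fromℤ d ℚ.- fromℤ b)
      ≡⟨ xyx⁻¹≈y (fromℤ b) (fromℤ d) ⟩
    fromℤ d ∎
    where
    xyx⁻¹≈y : ∀ x y → x ℚ.+ (y ℚ.- x) ≡ y
    xyx⁻¹≈y x y = trans (sym (ℚ.+-assoc x y (ℚ.- x))) (AbelianGroup.xyx⁻¹≈y x y)

  quotient≡1 : ℚ._÷_ (evalℚ f r) (fromℤ d) {{proj₁ sf}} ≡ 1ℚ ℚ.* 1ℚ
  quotient≡1 = trans
    (cong (λ v → ℚ._÷_ v (fromℤ d) {{proj₁ sf}}) f[r]≡d)
    (ℚ.*-inverseʳ (fromℤ d) {{proj₁ sf}})

squarefree-+ : ∀ n .{{_ : NonZero n}} → (∀ k → k * k ∣ n → k ≡ 1) → Squarefree (+ n)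
squarefree-+ (suc _) squarefree =
  _ , λ k k²∣n → squarefree ∣ k ∣ (subst (_∣ _) (ℤ.abs-* k k) k²∣n)

proposition3p4 : ∀ (f : ℤ[x].Poly) → ℤ[x].HasDegree f 1 →
    ∀ (p : ℕ) → Good f p →
    ∀ (m : ℤ) → Coprime m (+ p) →
    Infinite (λ d → d ∈ 𝒮 f × d ≡ m [mod p ])
proposition3p4 f deg p good m m⊥p xs =
  + x , (squarefree∈𝒮 f deg (+ x) (squarefree-+ x squarefree) , congruent (Signed.divides (+ B ℤ.+ + n ℤ.- q) x-m)) , x∉xs
  where
  instance
    p-nonZero : NonZero p
    p-nonZero = prime⇒nonZero (Good.prime good)

  B = suc (max 0 (map ∣_∣ xs))
  r = m ℤ.%ℕ p
  q = m ℤ./ℕ p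
  a = r + p * B

  B≤a : B ≤ a
  B≤a = ≤-trans (m≤n*m B p) (m≤n+m (p * B) r)

  instance
    a-nonZero : NonZero a
    a-nonZero = >-nonZero (≤-trans z<s B≤a)

  m≡r+qp : m ≡ + r ℤ.+ q ℤ.* + p
  m≡r+qp = ℤ.a≡a%ℕn+[a/ℕn]*n m p

  a⊥p : ℕ.Coprime a p
  a⊥p {d} (d∣a , d∣p) = m⊥p (Signed.∣⇒∣ᵤ {+ d} {m} d∣m , d∣p)
    where
    d∣r : d ∣ r
    d∣r = ∣m+n∣m⇒∣n (subst (d ∣_) (+-comm r (p * B)) d∣a) (∣m⇒∣m*n B d∣p)
    d∣m : + d Signed.∣ m
    d∣m = subst (+ d Signed.∣_) (sym m≡r+qp)
      (Signed.∣m∣n⇒∣m+n (Signed.∣ᵤ⇒∣ {+ d} {+ r} d∣r) (Signed.∣n⇒∣m*n q (Signed.∣ᵤ⇒∣ {+ d} {+ p} d∣p)))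

  n          = proj₁ (squarefree-in-progression a p a⊥p)
  squarefree = proj₂ (squarefree-in-progression a p a⊥p)
  x          = a + p * n

  instance
    x-nonZero : NonZero x
    x-nonZero = >-nonZero (≤-trans z<s (≤-trans B≤a (m≤m+n a (p * n))))

  x-m : + x ℤ.- m ≡ (+ B ℤ.+ + n ℤ.- q) ℤ.* + p
  x-m = begin
    + x ℤ.- m
      ≡⟨ cong₂ (λ u v → u ℤ.- v) x-expand m≡r+qp ⟩
    (+ r ℤ.+ + p ℤ.* + B ℤ.+ + p ℤ.* + n) ℤ.- (+ r ℤ.+ q ℤ.* + p)
      ≡⟨ cancel (+ r) (+ p) (+ B) (+ n) q ⟩
    (+ B ℤ.+ + n ℤ.- q) ℤ.* + p ∎
    where
    open ≡-Reasoning
    x-expand : + x ≡ + r ℤ.+ + p ℤ.* + B ℤ.+ + p ℤ.* + n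
    x-expand = cong₂ (λ u v → + r ℤ.+ u ℤ.+ v) (ℤ.pos-* p B) (ℤ.pos-* p n)
    cancel : ∀ r p B n q →
      (r ℤ.+ p ℤ.* B ℤ.+ p ℤ.* n) ℤ.- (r ℤ.+ q ℤ.* p) ≡ (B ℤ.+ n ℤ.- q) ℤ.* p
    cancel = solve-∀

  x∉xs : + x ∉ xs
  x∉xs x∈xs = <⇒≱ (≤-trans B≤a (m≤m+n a (p * n)))
    (All.lookup (xs≤max 0 (map ∣_∣ xs)) (∈-map⁺ ∣_∣ x∈xs))
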